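{- Let $q>c\ge 1$ be integers. Then $$v_0(q+1,c+1)\ \ge\ \frac{1}{c}\left(q^2+q+\frac{2(q-c+1)}{c+1}\right)+1.$$
   Context: For integers $k\ge t$, a $(v,k,t)$ packing of size $b$ is a system of $b$ subsets (blocks) of a $v$-element underlying set such that each block has exactly $k$ elements and every $t$-element set is contained in at most one block. $P(v,k,t)$ denotes the maximum possible size $b$ of a $(v,k,t)$ packing. $v_0(k,t)$ denotes the minimum $v$ such that $P(v,k,t)>v$. -}

module Defs where

open import Data.Nat using (ℕ; _≤_; _>_)
open import Data.Fin using (Fin)
open import Data.Fin.Subset using (Subset; ∣_∣; _⊆_)
open import Data.Product using (_×_; ∃-syntax)
open import Relation.Binary.PropositionalEquality using (_≡_)

-- The blocks are indexed by Fin b. When t ≤ k the last field makes `block`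
-- injective: a repeated block would give its t-subsets two indices. So for t ≤ k
-- an indexed system of b blocks is the same as a set of b distinct blocks.
record Packing (v k t b : ℕ) : Set where
  field
    block      : Fin b → Subset v
    block-size : ∀ i → ∣ block i ∣ ≡ k
    at-most-one : ∀ (T : Subset v) → ∣ T ∣ ≡ t →
                  ∀ i j → T ⊆ block i → T ⊆ block j → i ≡ j

IsMaximum : (ℕ → Set) → ℕ → Set
IsMaximum A m = A m × (∀ n → A n → n ≤ m)

IsMinimum : (ℕ → Set) → ℕ → Set
IsMinimum A m = A m × (∀ n → A n → m ≤ n)

-- P(v,k,t) = p, as a functional relation.
IsP : (v k t p : ℕ) → Set
IsP v k t = IsMaximum (Packing v k t)

-- v₀(k,t) = v, as a functional relation.
Isv₀ : (k t v : ℕ) → Set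
Isv₀ k t = IsMinimum (λ v → ∃[ p ] (IsP v k t p × p > v))

-- By averaging, some point x lies on N = q + 2 of the more than v₀ blocks. Any two blocks
-- share at most c points. Let m y count those of these N blocks that contain y;
-- then m x = N, Σ m = N (q + 1) and Σ m² ≤ N (q + 1) + N (N − 1) c. Since m is integral,
-- (m y − c) (m y − c − 1) ≥ 0 for all y; summing this, with the term at x kept exactly,
-- is the claimed bound on v₀.
module Submission where

open import Data.Nat using (ℕ; suc; _<_; NonZero)
open import Data.Integer as ℤ using (ℤ; +_)
open import Data.Rational.Unnormalised using (ℚᵘ; _/_; _+_; _*_; _≥_; 1ℚᵘ)
open import Defs

open import Data.Fin using (Fin; zero; suc)
open import Data.Fin.Properties as Fin using (¬∀⟶∃¬)
open import Data.Fin.Subset using (Subset; Side; inside; outside; ∣_∣; _⊆_; _∩_; ⊥)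
open import Data.Fin.Subset.Properties
  using (⊥⊆; ∣⊥∣≡0; p∩q⊆p; p∩q⊆q; ∩-idem; s⊆s)
import Data.Integer.Properties as ℤₚ
import Data.Integer.Tactic.RingSolver as ℤ-Solver
open import Data.Nat as ℕ using (zero; _≤_; z≤n; s≤s; _≤?_)
open import Data.Nat.Properties as ℕₚ using (+-*-semiring; module ≤-Reasoning)
open import Data.Nat.Tactic.RingSolver using (solve-∀)
open import Algebra.Properties.Semiring.Sum +-*-semiring
  using (sum; sum-syntax; sum-cong-≗; ∑-comm; ∑-distrib-+; *-distribˡ-sum; *-distribʳ-sum)
open import Data.Product using (∃-syntax; _×_; _,_)
open import Data.Rational.Unnormalised using (*≤*)
open import Data.Vec using ([]; _∷_; lookup; tabulate)
open import Data.Vec.Properties using ([]=⇒lookup; lookup⇒[]=; lookup∘tabulate)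
open import Function using (_∘_)
open import Relation.Binary.PropositionalEquality
open import Relation.Nullary using (¬_; yes; no; contradiction)

private
  variable
    n : ℕ

-- Comparison of finite sums, and subsets of prescribed size

∑-mono : ∀ {f g : Fin n → ℕ} → (∀ y → f y ≤ g y) → sum f ≤ sum g
∑-mono {n = zero}  f≤g = z≤n
∑-mono {n = suc n} f≤g = ℕₚ.+-mono-≤ (f≤g zero) (∑-mono (f≤g ∘ suc))

-- The slacks `a` and `b` let one term be compared on its own terms: they carry the exact surplus at
-- the distinguished point, and the excess of the diagonal term when block intersections are summed.
∑-mono-except : ∀ (x : Fin n) {f g : Fin n → ℕ} {a b} →
                (∀ y → y ≢ x → f y ≤ g y) → f x ℕ.+ a ≤ g x ℕ.+ b →
                sum f ℕ.+ a ≤ sum g ℕ.+ b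
∑-mono-except zero {f} {g} {a} {b} f≤g fx≤gx = begin
  f zero ℕ.+ sum (f ∘ suc) ℕ.+ a   ≡⟨ swap (f zero) _ a ⟩
  f zero ℕ.+ a ℕ.+ sum (f ∘ suc)   ≤⟨ ℕₚ.+-mono-≤ fx≤gx (∑-mono λ y → f≤g (suc y) λ ()) ⟩
  g zero ℕ.+ b ℕ.+ sum (g ∘ suc)   ≡⟨ swap (g zero) b _ ⟩
  g zero ℕ.+ sum (g ∘ suc) ℕ.+ b   ∎
  where
  open ≤-Reasoning
  swap : ∀ i j k → i ℕ.+ j ℕ.+ k ≡ i ℕ.+ k ℕ.+ j
  swap = solve-∀
∑-mono-except (suc x) {f} {g} {a} {b} f≤g fx≤gx = begin
  f zero ℕ.+ sum (f ∘ suc) ℕ.+ a    ≡⟨ ℕₚ.+-assoc (f zero) _ a ⟩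
  f zero ℕ.+ (sum (f ∘ suc) ℕ.+ a)  ≤⟨ ℕₚ.+-mono-≤ (f≤g zero λ ())
                                        (∑-mono-except x (λ y y≢x → f≤g (suc y) (y≢x ∘ Fin.suc-injective)) fx≤gx) ⟩
  g zero ℕ.+ (sum (g ∘ suc) ℕ.+ b)  ≡⟨ ℕₚ.+-assoc (g zero) _ b ⟨
  g zero ℕ.+ sum (g ∘ suc) ℕ.+ b    ∎
  where open ≤-Reasoning

∑-const : ∀ n k → ∑[ i < n ] k ≡ n ℕ.* k
∑-const zero    k = refl
∑-const (suc n) k = cong (k ℕ.+_) (∑-const n k)

subset-of-size : ∀ k (p : Subset n) → k ≤ ∣ p ∣ → ∃[ T ] (T ⊆ p × ∣ T ∣ ≡ k)
subset-of-size {n} zero p            _          = ⊥ , ⊥⊆ , ∣⊥∣≡0 n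
subset-of-size (suc k) (outside ∷ p) k<∣p∣     with T , T⊆p , ∣T∣ ← subset-of-size (suc k) p k<∣p∣
  = outside ∷ T , s⊆s T⊆p , ∣T∣
subset-of-size (suc k) (inside ∷ p) (s≤s k≤∣p∣) with T , T⊆p , ∣T∣ ← subset-of-size k p k≤∣p∣
  = inside ∷ T , s⊆s T⊆p , cong suc ∣T∣

-- Indicator functions with values in the naturals

indicator : Side → ℕ
indicator inside  = 1
indicator outside = 0

χ : Subset n → Fin n → ℕ
χ p i = indicator (lookup p i)

χ≤1 : ∀ (p : Subset n) i → χ p i ≤ 1
χ≤1 p i with lookup p i
... | inside  = s≤s z≤n
... | outside = z≤n

∣p∣≡∑χ : ∀ (p : Subset n) → ∣ p ∣ ≡ ∑[ i < n ] χ p i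
∣p∣≡∑χ []            = refl
∣p∣≡∑χ (inside  ∷ p) = cong suc (∣p∣≡∑χ p)
∣p∣≡∑χ (outside ∷ p) = ∣p∣≡∑χ p

∣p∩q∣≡∑χ*χ : ∀ (p q : Subset n) → ∣ p ∩ q ∣ ≡ ∑[ i < n ] (χ p i ℕ.* χ q i)
∣p∩q∣≡∑χ*χ []            []            = refl
∣p∩q∣≡∑χ*χ (inside  ∷ p) (inside  ∷ q) = cong suc (∣p∩q∣≡∑χ*χ p q)
∣p∩q∣≡∑χ*χ (inside  ∷ p) (outside ∷ q) = ∣p∩q∣≡∑χ*χ p q
∣p∩q∣≡∑χ*χ (outside ∷ p) (_       ∷ q) = ∣p∩q∣≡∑χ*χ p q

-- Incidences between points and blocks

module _ {v b} (block : Fin b → Subset v) where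

  blocksThrough : Fin v → Subset b
  blocksThrough x = tabulate λ i → lookup (block i) x

  χ-blocksThrough : ∀ x i → χ (blocksThrough x) i ≡ χ (block i) x
  χ-blocksThrough x i = cong indicator (lookup∘tabulate _ i)

  ∑∣blocksThrough∣ : ∀ {k} → (∀ i → ∣ block i ∣ ≡ k) → ∑[ x < v ] ∣ blocksThrough x ∣ ≡ b ℕ.* k
  ∑∣blocksThrough∣ {k} size = begin
    ∑[ x < v ] ∣ blocksThrough x ∣        ≡⟨ sum-cong-≗ (λ x → trans (∣p∣≡∑χ (blocksThrough x)) (sum-cong-≗ (χ-blocksThrough x))) ⟩
    ∑[ x < v ] ∑[ i < b ] χ (block i) x   ≡⟨ ∑-comm {v} {b} (λ x i → χ (block i) x) ⟩
    ∑[ i < b ] ∑[ x < v ] χ (block i) x   ≡⟨ sum-cong-≗ (λ i → trans (sym (∣p∣≡∑χ (block i))) (size i)) ⟩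
    ∑[ i < b ] k                          ≡⟨ ∑-const b k ⟩
    b ℕ.* k                               ∎
    where open ≡-Reasoning

  -- Averaging: the degrees sum to `b * k`, so if all were at most `k`, then `b * k ≤ v * k` and
  -- hence `b ≤ v`.
  point-of-large-degree : ∀ {k} .{{_ : NonZero k}} → (∀ i → ∣ block i ∣ ≡ k) → v < b →
                          ∃[ x ] k < ∣ blocksThrough x ∣
  point-of-large-degree {k} size v<b =
    let x , r≰k = ¬∀⟶∃¬ v (λ x → ∣ blocksThrough x ∣ ≤ k) (λ x → ∣ blocksThrough x ∣ ≤? k) not-all
    in  x , ℕₚ.≰⇒> r≰k
    where
    not-all : ¬ (∀ x → ∣ blocksThrough x ∣ ≤ k)
    not-all all≤k = ℕₚ.<⇒≱ v<b (ℕₚ.*-cancelʳ-≤ b v k (begin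
      b ℕ.* k                          ≡⟨ ∑∣blocksThrough∣ size ⟨
      ∑[ x < v ] ∣ blocksThrough x ∣   ≤⟨ ∑-mono all≤k ⟩
      ∑[ x < v ] k                     ≡⟨ ∑-const v k ⟩
      v ℕ.* k                          ∎))
      where open ≤-Reasoning

  -- First and second moments of the degrees

  degree : Subset b → Fin v → ℕ
  degree S y = ∑[ i < b ] (χ S i ℕ.* χ (block i) y)

  -- Double counting with a weight `f` on the points. Weight 1 gives the first moment, `degree S`
  -- opens the second moment, and the indicator of a block turns its row into a sum of intersection
  -- sizes.
  ∑-degree-* : ∀ S (f : Fin v → ℕ) →
    ∑[ y < v ] (degree S y ℕ.* f y) ≡ ∑[ i < b ] (χ S i ℕ.* ∑[ y < v ] (χ (block i) y ℕ.* f y))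
  ∑-degree-* S f = begin
    ∑[ y < v ] (degree S y ℕ.* f y)
      ≡⟨ sum-cong-≗ (λ y → *-distribʳ-sum (f y) (λ i → χ S i ℕ.* χ (block i) y)) ⟩
    ∑[ y < v ] ∑[ i < b ] (χ S i ℕ.* χ (block i) y ℕ.* f y)
      ≡⟨ ∑-comm {v} {b} (λ y i → χ S i ℕ.* χ (block i) y ℕ.* f y) ⟩
    ∑[ i < b ] ∑[ y < v ] (χ S i ℕ.* χ (block i) y ℕ.* f y)
      ≡⟨ sum-cong-≗ (λ i → trans (sum-cong-≗ (λ y → ℕₚ.*-assoc (χ S i) (χ (block i) y) (f y)))
                                 (sym (*-distribˡ-sum (χ S i) (λ y → χ (block i) y ℕ.* f y)))) ⟩
    ∑[ i < b ] (χ S i ℕ.* ∑[ y < v ] (χ (block i) y ℕ.* f y)) ∎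
    where open ≡-Reasoning

  ∑χ*const : ∀ (S : Subset b) k → ∑[ i < b ] (χ S i ℕ.* k) ≡ ∣ S ∣ ℕ.* k
  ∑χ*const S k = trans (sym (*-distribʳ-sum k (χ S))) (cong (ℕ._* k) (sym (∣p∣≡∑χ S)))

  degree-common : ∀ S x → S ⊆ blocksThrough x → degree S x ≡ ∣ S ∣
  degree-common S x S⊆ = trans (sum-cong-≗ χ*χ≡χ) (sym (∣p∣≡∑χ S))
    where
    χ*χ≡χ : ∀ i → χ S i ℕ.* χ (block i) x ≡ χ S i
    χ*χ≡χ i with lookup S i in i∈S
    ... | outside = refl
    ... | inside  = trans (ℕₚ.*-identityˡ _) (trans (sym (χ-blocksThrough x i))
                      (cong indicator ([]=⇒lookup (S⊆ (lookup⇒[]= i S i∈S)))))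

  ∑-degree : ∀ {k} S → (∀ i → ∣ block i ∣ ≡ k) → ∑[ y < v ] degree S y ≡ ∣ S ∣ ℕ.* k
  ∑-degree {k} S size = begin
    ∑[ y < v ] degree S y                                     ≡⟨ sum-cong-≗ (λ y → ℕₚ.*-identityʳ (degree S y)) ⟨
    ∑[ y < v ] (degree S y ℕ.* 1)                             ≡⟨ ∑-degree-* S (λ _ → 1) ⟩
    ∑[ i < b ] (χ S i ℕ.* ∑[ y < v ] (χ (block i) y ℕ.* 1))   ≡⟨ sum-cong-≗ (λ i → cong (χ S i ℕ.*_) (∑χ*1 i)) ⟩
    ∑[ i < b ] (χ S i ℕ.* k)                                  ≡⟨ ∑χ*const S k ⟩
    ∣ S ∣ ℕ.* k                                               ∎
    where
    open ≡-Reasoning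
    ∑χ*1 : ∀ i → ∑[ y < v ] (χ (block i) y ℕ.* 1) ≡ k
    ∑χ*1 i = trans (sum-cong-≗ (λ y → ℕₚ.*-identityʳ (χ (block i) y)))
                   (trans (sym (∣p∣≡∑χ (block i))) (size i))

  -- The second moment counts ordered pairs of blocks from `S` by their common points. Writing the
  -- block size as `c + e` gives every pair a share of at most `c`, and the pair of a block with
  -- itself the extra `e`.
  ∑-degree² : ∀ {c e} S → (∀ i → ∣ block i ∣ ≡ c ℕ.+ e) → (∀ i j → i ≢ j → ∣ block i ∩ block j ∣ ≤ c) →
              ∑[ y < v ] (degree S y ℕ.* degree S y) ≤ ∣ S ∣ ℕ.* (∣ S ∣ ℕ.* c ℕ.+ e)
  ∑-degree² {c} {e} S size meet = begin
    ∑[ y < v ] (degree S y ℕ.* degree S y)                             ≡⟨ ∑-degree-* S (degree S) ⟩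
    ∑[ i < b ] (χ S i ℕ.* ∑[ y < v ] (χ (block i) y ℕ.* degree S y))   ≤⟨ ∑-mono (λ i → ℕₚ.*-monoʳ-≤ (χ S i) (row i)) ⟩
    ∑[ i < b ] (χ S i ℕ.* (∣ S ∣ ℕ.* c ℕ.+ e))                         ≡⟨ ∑χ*const S _ ⟩
    ∣ S ∣ ℕ.* (∣ S ∣ ℕ.* c ℕ.+ e)                                      ∎
    where
    open ≤-Reasoning
    -- The index `i` need not lie in `S`; if it does not, the left side vanishes.
    diagonal : ∀ i → χ S i ℕ.* ∣ block i ∩ block i ∣ ℕ.+ 0 ≤ χ S i ℕ.* c ℕ.+ e
    diagonal i = begin
      χ S i ℕ.* ∣ block i ∩ block i ∣ ℕ.+ 0   ≡⟨ ℕₚ.+-identityʳ _ ⟩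
      χ S i ℕ.* ∣ block i ∩ block i ∣         ≡⟨ cong (χ S i ℕ.*_) (trans (cong ∣_∣ (∩-idem (block i))) (size i)) ⟩
      χ S i ℕ.* (c ℕ.+ e)                     ≡⟨ ℕₚ.*-distribˡ-+ (χ S i) c e ⟩
      χ S i ℕ.* c ℕ.+ χ S i ℕ.* e             ≤⟨ ℕₚ.+-monoʳ-≤ (χ S i ℕ.* c) (ℕₚ.*-monoˡ-≤ e (χ≤1 S i)) ⟩
      χ S i ℕ.* c ℕ.+ 1 ℕ.* e                 ≡⟨ cong (χ S i ℕ.* c ℕ.+_) (ℕₚ.*-identityˡ e) ⟩
      χ S i ℕ.* c ℕ.+ e                       ∎
    row : ∀ i → ∑[ y < v ] (χ (block i) y ℕ.* degree S y) ≤ ∣ S ∣ ℕ.* c ℕ.+ e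
    row i = begin
      ∑[ y < v ] (χ (block i) y ℕ.* degree S y)
        ≡⟨ sum-cong-≗ (λ y → ℕₚ.*-comm (χ (block i) y) (degree S y)) ⟩
      ∑[ y < v ] (degree S y ℕ.* χ (block i) y)
        ≡⟨ ∑-degree-* S (χ (block i)) ⟩
      ∑[ j < b ] (χ S j ℕ.* ∑[ y < v ] (χ (block j) y ℕ.* χ (block i) y))
        ≡⟨ sum-cong-≗ (λ j → cong (χ S j ℕ.*_) (∣p∩q∣≡∑χ*χ (block j) (block i))) ⟨
      ∑[ j < b ] (χ S j ℕ.* ∣ block j ∩ block i ∣)
        ≡⟨ ℕₚ.+-identityʳ _ ⟨
      ∑[ j < b ] (χ S j ℕ.* ∣ block j ∩ block i ∣) ℕ.+ 0
        ≤⟨ ∑-mono-except i (λ j j≢i → ℕₚ.*-monoʳ-≤ (χ S j) (meet j i j≢i)) (diagonal i) ⟩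
      ∑[ j < b ] (χ S j ℕ.* c) ℕ.+ e
        ≡⟨ cong (ℕ._+ e) (∑χ*const S c) ⟩
      ∣ S ∣ ℕ.* c ℕ.+ e ∎

-- (m − c) (m − c − 1) ≥ 0, with both sides moved so that no subtraction occurs.
integrality : ∀ c m → (2 ℕ.* c ℕ.+ 1) ℕ.* m ≤ m ℕ.* m ℕ.+ c ℕ.* suc c
integrality c m with m ≤? c
... | yes m≤c with k , refl ← ℕₚ.m≤n⇒∃[o]m+o≡n m≤c =
  subst ((2 ℕ.* (m ℕ.+ k) ℕ.+ 1) ℕ.* m ≤_) (below m k) (ℕₚ.m≤m+n _ (k ℕ.* suc k))
  where
  below : ∀ m k → (2 ℕ.* (m ℕ.+ k) ℕ.+ 1) ℕ.* m ℕ.+ k ℕ.* suc k ≡ m ℕ.* m ℕ.+ (m ℕ.+ k) ℕ.* suc (m ℕ.+ k)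
  below = solve-∀
... | no m≰c with k , refl ← ℕₚ.m≤n⇒∃[o]m+o≡n (ℕₚ.≰⇒> m≰c) =
  subst ((2 ℕ.* c ℕ.+ 1) ℕ.* (suc c ℕ.+ k) ≤_) (above c k) (ℕₚ.m≤m+n _ (k ℕ.* suc k))
  where
  above : ∀ c k → (2 ℕ.* c ℕ.+ 1) ℕ.* (suc c ℕ.+ k) ℕ.+ k ℕ.* suc k ≡ (suc c ℕ.+ k) ℕ.* (suc c ℕ.+ k) ℕ.+ c ℕ.* suc c
  above = solve-∀

-- The counting bound for packings

packing-meet : ∀ {v k c b} (P : Packing v k (suc c) b) → let open Packing P in
               ∀ i j → i ≢ j → ∣ block i ∩ block j ∣ ≤ c
packing-meet {c = c} P i j i≢j with ∣ Packing.block P i ∩ Packing.block P j ∣ ≤? c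
... | yes ≤c = ≤c
-- An intersection of more than `c` points would contain a set of size `suc c` lying in two
-- different blocks.
... | no  ≰c with T , T⊆ , ∣T∣ ← subset-of-size (suc c) _ (ℕₚ.≰⇒> ≰c) =
  contradiction (at-most-one T ∣T∣ i j (λ x∈ → p∩q⊆p (block i) (block j) (T⊆ x∈))
                                       (λ x∈ → p∩q⊆q (block i) (block j) (T⊆ x∈))) i≢j
  where open Packing P

-- The claimed inequality multiplied by `c * suc c`. Writing `q` as `suc c + d` encodes `c < q` and
-- turns q - c + 1 into `d + 2`, so everything stays in the naturals.
packing-bound : ∀ {v b} c d → let q = suc c ℕ.+ d in
                Packing v (suc q) (suc c) b → v < b →
                suc c ℕ.* (q ℕ.* q ℕ.+ q) ℕ.+ 2 ℕ.* (d ℕ.+ 2) ℕ.+ c ℕ.* suc c ≤ v ℕ.* (c ℕ.* suc c)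
packing-bound {v} {b} c d P v<b
  with x , large ← point-of-large-degree (Packing.block P) (Packing.block-size P) v<b
  -- The degree of `x` exceeds `suc q`; exactly q + 2 of its blocks are kept, so that all later
  -- quantities are polynomials in `c` and `d`.
  with S , S⊆ , ∣S∣ ← subset-of-size (suc (suc (suc c ℕ.+ d))) _ large
  -- The upper bound on the second moment is added to both sides, which avoids subtracting it.
  = ℕₚ.+-cancelʳ-≤ (N ℕ.* (N ℕ.* c ℕ.+ e)) _ _ (begin
      suc c ℕ.* (q ℕ.* q ℕ.+ q) ℕ.+ 2 ℕ.* (d ℕ.+ 2) ℕ.+ c ℕ.* suc c ℕ.+ N ℕ.* (N ℕ.* c ℕ.+ e)
        ≡⟨ arithmetic c d ⟩
      (2 ℕ.* c ℕ.+ 1) ℕ.* (N ℕ.* suc q) ℕ.+ e ℕ.* suc e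
        ≡⟨ cong (λ z → (2 ℕ.* c ℕ.+ 1) ℕ.* z ℕ.+ e ℕ.* suc e)
             (trans (∑-degree block S block-size) (cong (ℕ._* suc q) ∣S∣)) ⟨
      (2 ℕ.* c ℕ.+ 1) ℕ.* ∑[ y < v ] m y ℕ.+ e ℕ.* suc e
        ≡⟨ cong (ℕ._+ e ℕ.* suc e) (*-distribˡ-sum (2 ℕ.* c ℕ.+ 1) m) ⟩
      ∑[ y < v ] ((2 ℕ.* c ℕ.+ 1) ℕ.* m y) ℕ.+ e ℕ.* suc e
        ≤⟨ ∑-mono-except x (λ y _ → integrality c (m y)) at-x ⟩
      ∑[ y < v ] (m y ℕ.* m y ℕ.+ c ℕ.* suc c) ℕ.+ 0
        ≡⟨ ℕₚ.+-identityʳ _ ⟩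
      ∑[ y < v ] (m y ℕ.* m y ℕ.+ c ℕ.* suc c)
        ≡⟨ ∑-distrib-+ (λ y → m y ℕ.* m y) (λ _ → c ℕ.* suc c) ⟩
      ∑[ y < v ] (m y ℕ.* m y) ℕ.+ ∑[ y < v ] (c ℕ.* suc c)
        ≡⟨ cong (∑[ y < v ] (m y ℕ.* m y) ℕ.+_) (∑-const v (c ℕ.* suc c)) ⟩
      ∑[ y < v ] (m y ℕ.* m y) ℕ.+ v ℕ.* (c ℕ.* suc c)
        ≤⟨ ℕₚ.+-monoˡ-≤ _ (∑-degree² block S size (packing-meet P)) ⟩
      ∣ S ∣ ℕ.* (∣ S ∣ ℕ.* c ℕ.+ e) ℕ.+ v ℕ.* (c ℕ.* suc c)
        ≡⟨ cong (λ z → z ℕ.* (z ℕ.* c ℕ.+ e) ℕ.+ v ℕ.* (c ℕ.* suc c)) ∣S∣ ⟩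
      N ℕ.* (N ℕ.* c ℕ.+ e) ℕ.+ v ℕ.* (c ℕ.* suc c)
        ≡⟨ ℕₚ.+-comm (N ℕ.* (N ℕ.* c ℕ.+ e)) _ ⟩
      v ℕ.* (c ℕ.* suc c) ℕ.+ N ℕ.* (N ℕ.* c ℕ.+ e) ∎)
  where
  open ≤-Reasoning
  open Packing P
  -- Here `e` is both the block size minus c and N - c - 1. Hence `e * suc e` is the exact value of
  -- (m - c)(m - c - 1) at `x`, where m = N.
  q N e : ℕ
  q = suc c ℕ.+ d
  N = suc (suc q)
  e = d ℕ.+ 2
  m : Fin v → ℕ
  m = degree block S

  size : ∀ i → ∣ block i ∣ ≡ c ℕ.+ e
  size i = trans (block-size i) (k≡c+e c d)
    where
    k≡c+e : ∀ c d → suc (suc c ℕ.+ d) ≡ c ℕ.+ (d ℕ.+ 2)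
    k≡c+e = solve-∀

  at-x : (2 ℕ.* c ℕ.+ 1) ℕ.* m x ℕ.+ e ℕ.* suc e ≤ m x ℕ.* m x ℕ.+ c ℕ.* suc c ℕ.+ 0
  at-x rewrite trans (degree-common block S x S⊆) ∣S∣ = ℕₚ.≤-reflexive (excess c d)
    where
    excess : ∀ c d → (2 ℕ.* c ℕ.+ 1) ℕ.* suc (suc (suc c ℕ.+ d)) ℕ.+ (d ℕ.+ 2) ℕ.* suc (d ℕ.+ 2)
                     ≡ suc (suc (suc c ℕ.+ d)) ℕ.* suc (suc (suc c ℕ.+ d)) ℕ.+ c ℕ.* suc c ℕ.+ 0
    excess = solve-∀

  arithmetic : ∀ c d →
    suc c ℕ.* ((suc c ℕ.+ d) ℕ.* (suc c ℕ.+ d) ℕ.+ (suc c ℕ.+ d)) ℕ.+ 2 ℕ.* (d ℕ.+ 2) ℕ.+ c ℕ.* suc c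
      ℕ.+ suc (suc (suc c ℕ.+ d)) ℕ.* (suc (suc (suc c ℕ.+ d)) ℕ.* c ℕ.+ (d ℕ.+ 2))
    ≡ (2 ℕ.* c ℕ.+ 1) ℕ.* (suc (suc (suc c ℕ.+ d)) ℕ.* suc (suc c ℕ.+ d)) ℕ.+ (d ℕ.+ 2) ℕ.* suc (d ℕ.+ 2)
  arithmetic = solve-∀

-- Passage to rational numbers

bound-ℚ : ∀ c d v .{{_ : NonZero c}} → let q = suc c ℕ.+ d in
          suc c ℕ.* (q ℕ.* q ℕ.+ q) ℕ.+ 2 ℕ.* (d ℕ.+ 2) ℕ.+ c ℕ.* suc c ≤ v ℕ.* (c ℕ.* suc c) →
          (+ v) / 1 ≥ ((+ 1) / c) * ((+ q ℤ.* + q ℤ.+ + q) / 1 + (+ 2 ℤ.* (+ q ℤ.- + c ℤ.+ + 1)) / suc c) + 1ℚᵘ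
-- Matching `c` as a successor lets `/` compute, so the order on fractions becomes a
-- cross-multiplied inequality of integers.
bound-ℚ c@(suc c-1) d v bound = *≤* (subst₂ ℤ._≤_ numerators denominators (ℤ.+≤+ bound))
  where
  open ≡-Reasoning
  q = suc c ℕ.+ d

  denominators : + (v ℕ.* (c ℕ.* suc c)) ≡ + v ℤ.* + (c ℕ.* (1 ℕ.* suc c) ℕ.* 1)
  denominators = trans (cong (λ z → + (v ℕ.* z)) (units c)) (ℤₚ.pos-* v _)
    where
    units : ∀ c → c ℕ.* suc c ≡ c ℕ.* (1 ℕ.* suc c) ℕ.* 1
    units = solve-∀

  -- The shape, with its factors 1, is what unnormalised addition and multiplication produce. The
  -- argument stands for the denominator of the product, so that its cast can be rewritten
  -- separately.
  numerator : ℤ → ℤ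
  numerator z = (+ 1 ℤ.* ((+ q ℤ.* + q ℤ.+ + q) ℤ.* + suc c ℤ.+ (+ 2 ℤ.* (+ q ℤ.- + c ℤ.+ + 1)) ℤ.* + 1) ℤ.* + 1
                 ℤ.+ + 1 ℤ.* z) ℤ.* + 1

  numerators : + (suc c ℕ.* (q ℕ.* q ℕ.+ q) ℕ.+ 2 ℕ.* (d ℕ.+ 2) ℕ.+ c ℕ.* suc c)
             ≡ numerator (+ (c ℕ.* (1 ℕ.* suc c)))
  numerators = begin
    + (suc c ℕ.* (q ℕ.* q ℕ.+ q)) ℤ.+ + (2 ℕ.* (d ℕ.+ 2)) ℤ.+ + (c ℕ.* suc c)
      ≡⟨ cong₂ ℤ._+_ (cong₂ ℤ._+_ (trans (ℤₚ.pos-* (suc c) (q ℕ.* q ℕ.+ q))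
                                         (cong (λ z → + suc c ℤ.* (z ℤ.+ + q)) (ℤₚ.pos-* q q)))
                                  (ℤₚ.pos-* 2 (d ℕ.+ 2)))
                     (ℤₚ.pos-* c (suc c)) ⟩
    + suc c ℤ.* (+ q ℤ.* + q ℤ.+ + q) ℤ.+ + 2 ℤ.* (+ d ℤ.+ + 2) ℤ.+ + c ℤ.* + suc c
      ≡⟨ rearrange (+ c) (+ d) ⟩
    numerator (+ c ℤ.* (+ 1 ℤ.* + suc c))
      ≡⟨ cong numerator (trans (ℤₚ.pos-* c (1 ℕ.* suc c)) (cong (+ c ℤ.*_) (ℤₚ.pos-* 1 (suc c)))) ⟨
    numerator (+ (c ℕ.* (1 ℕ.* suc c))) ∎
    where
    rearrange : ∀ x y → let s = + 1 ℤ.+ x ; z = s ℤ.+ y in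
      s ℤ.* (z ℤ.* z ℤ.+ z) ℤ.+ + 2 ℤ.* (y ℤ.+ + 2) ℤ.+ x ℤ.* s
      ≡ (+ 1 ℤ.* ((z ℤ.* z ℤ.+ z) ℤ.* s ℤ.+ (+ 2 ℤ.* (z ℤ.- x ℤ.+ + 1)) ℤ.* + 1) ℤ.* + 1
         ℤ.+ + 1 ℤ.* (x ℤ.* (+ 1 ℤ.* s))) ℤ.* + 1
    rearrange = ℤ-Solver.solve-∀

claim3 : (q c : ℕ) → .{{_ : NonZero c}} → c < q →
    (v₀ : ℕ) → Isv₀ (suc q) (suc c) v₀ →
    (+ v₀) / 1 ≥ ((+ 1) / c) * ((+ q ℤ.* + q ℤ.+ + q) / 1 + (+ 2 ℤ.* (+ q ℤ.- + c ℤ.+ + 1)) / suc c) + 1ℚᵘ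
-- A maximum is attained, so `p > v₀` comes with an actual packing of `p` blocks; `d` is q - c - 1.
claim3 q c c<q v₀ ((p , (P , _) , p>v₀) , _) with d , refl ← ℕₚ.m≤n⇒∃[o]m+o≡n c<q =
  bound-ℚ c d v₀ (packing-bound c d P p>v₀)
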